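{- (Provable in $\mathrm{ZF}+\mathrm{DC}$.) Let $U$ be an ultrafilter on $\omega$ and let $f,g:\omega\to\omega$ satisfy $0<\lim_U \frac{f(n)}{g(n)}<\infty$. If $\prod_n (f(n),<)/U$ and $\prod_n (g(n),<)/U$ are both infinite, then $\prod_n (f(n),<)/U\cong\prod_n (g(n),<)/U$.
   Context: Each natural number $k$ is identified with $\{0,\dots,k-1\}$. $\prod_n (f(n),<)/U$ denotes the ultraproduct of the finite linear orders $(f(n),<)$: functions $x$ with $x(n)\in f(n)$ for all $n$, modulo $x=_Uy$ iff $\{n:x(n)=y(n)\}\in U$, ordered by $[x]<[y]$ iff $\{n:x(n)<y(n)\}\in U$. For a sequence of reals $(x_n)$, $\lim_U x_n$ is the unique $x\in\mathbb{R}\cup\{\pm\infty\}$ such that for every open neighborhood $O$ of $x$, $\{n:x_n\in O\}\in U$. -}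

module Defs where

open import Data.Nat using (ℕ; zero; suc; _+_; _*_; _>_; _<_)
open import Data.Fin as F using (Fin)
open import Data.Product using (Σ; ∃; _×_; _,_)
open import Data.Sum using (_⊎_)
open import Data.Unit using (⊤)
open import Data.Empty using (⊥)
open import Relation.Nullary using (¬_)
open import Relation.Binary.PropositionalEquality using (_≡_)

Pred : Set₁
Pred = ℕ → Set

record IsUltrafilter (U : Pred → Set) : Set₁ where
  field
    full    : U (λ _ → ⊤)
    proper  : ¬ U (λ _ → ⊥)
    upward  : ∀ (A B : Pred) → (∀ n → A n → B n) → U A → U B
    inter   : ∀ (A B : Pred) → U A → U B → U (λ n → A n × B n)
    ultra   : ∀ (A : Pred) → U A ⊎ U (λ n → ¬ A n)

-- Elements (representatives) of ∏ₙ (f n , <) / U : functions x with x n ∈ f n.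
Elt : (ℕ → ℕ) → Set
Elt f = (n : ℕ) → Fin (f n)

_≈[_]_ : {f : ℕ → ℕ} → Elt f → (Pred → Set) → Elt f → Set
x ≈[ U ] y = U (λ n → x n ≡ y n)

_<[_]_ : {f : ℕ → ℕ} → Elt f → (Pred → Set) → Elt f → Set
x <[ U ] y = U (λ n → x n F.< y n)

UPFinite : (Pred → Set) → (ℕ → ℕ) → Set
UPFinite U f = Σ ℕ λ k → Σ (Fin k → Elt f) λ e → ∀ (x : Elt f) → ∃ λ i → x ≈[ U ] e i

UPInfinite : (Pred → Set) → (ℕ → ℕ) → Set
UPInfinite U f = ¬ UPFinite U f

-- Order isomorphism  ∏ₙ (f n,<)/U ≅ ∏ₙ (g n,<)/U, given on representatives:
-- a map compatible with =_U, inducing a bijection of classes, and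
-- preserving and reflecting the order.
UPIso : (Pred → Set) → (ℕ → ℕ) → (ℕ → ℕ) → Set
UPIso U f g =
  Σ (Elt f → Elt g) λ F →
      (∀ x y → x ≈[ U ] y → F x ≈[ U ] F y)
    × (∀ x y → F x ≈[ U ] F y → x ≈[ U ] y)
    × (∀ (z : Elt g) → ∃ λ x → F x ≈[ U ] z)
    × (∀ x y → (x <[ U ] y → F x <[ U ] F y) × (F x <[ U ] F y → x <[ U ] y))

-- 0 < lim_U f(n)/g(n):  some positive rational a/b (a, b ≥ 1) has
-- {n : f(n)/g(n) ∈ (a/b, ∞)} ∈ U  (with g(n) ≠ 0 so the quotient is defined),
-- written by cross-multiplication  a·g(n) < b·f(n).
LimRatioPos : (Pred → Set) → (ℕ → ℕ) → (ℕ → ℕ) → Set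
LimRatioPos U f g =
  Σ ℕ λ a → Σ ℕ λ b → U (λ n → g n > 0 × suc a * g n < suc b * f n)

-- lim_U f(n)/g(n) < ∞:  some rational c/d has {n : f(n)/g(n) ∈ (-∞, c/d)} ∈ U,
-- written  d·f(n) < c·g(n)  (d ≥ 1, g(n) ≠ 0).
LimRatioFinite : (Pred → Set) → (ℕ → ℕ) → (ℕ → ℕ) → Set
LimRatioFinite U f g =
  Σ ℕ λ c → Σ ℕ λ d → U (λ n → g n > 0 × suc d * f n < c * g n)

{-# OPTIONS --safe #-}
module Submission where

-- Let t be the standard part of x / f.  The map x ↦ x − ⌊t f⌋ + ⌊t g⌋, with the
-- floors taken at each n, translates the elements infinitely close to t f
-- (relative to f) onto the elements infinitely close to t g (relative to g);
-- infinitesimal means the same relative to f and to g, as f / g is bounded both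
-- ways.
-- The base points ⌊t f⌋ and ⌊t g⌋ are determined by the standard real t, so no
-- choice is made, and since the image has the same standard part t relative
-- to g, exchanging f and g gives the inverse.
--
-- Statements A ∈ U are decidable, hence stable under double negation: this
-- makes t computable and classical reasoning available for every claim of
-- the form A ∈ U.

open import Defs
open import Data.Bool using (if_then_else_)
open import Data.Empty using (⊥-elim)
open import Data.Fin as F using (Fin; toℕ)
open import Data.Fin.Properties using (toℕ<n; toℕ-fromℕ<; toℕ-injective; toℕ-inject₁; toℕ-fromℕ)
open import Data.Nat using (ℕ; zero; suc; _+_; _*_; _∸_; _≤_; _<_; z≤n; s≤s; NonZero; >-nonZero; _/_; _%_)
open import Data.Nat.DivMod using (_mod_; m≡m%n+[m/n]*n; m/n*n≤m; m<n⇒m%n≡m; m%n≤n)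
open import Data.Nat.Properties
open import Data.Nat.Tactic.RingSolver using (solve-∀)
open import Data.Product using (Σ; ∃; _×_; _,_)
open import Data.Sum using (inj₁; inj₂)
open import Function using (_∘_)
open import Relation.Binary.PropositionalEquality using (_≡_; refl; sym; trans; cong; subst; subst₂)
open import Relation.Nullary using (¬_; Dec; yes; no; does; contradiction)
open import Relation.Nullary.Decidable using (map′)
open import Relation.Unary using (Decidable)

open ≤-Reasoning

-- Bounded search and reduction modulo `m`

module _ {P : ℕ → Set} (P? : Decidable P) where

  largest : ℕ → ℕ
  largest zero    = 0
  largest (suc m) = if does (P? (suc m)) then suc m else largest m

  largest-≤ : ∀ m → largest m ≤ m
  largest-≤ zero = z≤n
  largest-≤ (suc m) with P? (suc m)
  ... | yes _ = ≤-refl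
  ... | no  _ = m≤n⇒m≤1+n (largest-≤ m)

  largest-satisfies : P 0 → ∀ m → P (largest m)
  largest-satisfies p zero = p
  largest-satisfies p (suc m) with P? (suc m)
  ... | yes q = q
  ... | no  _ = largest-satisfies p m

  largest-maximal : ∀ m {j} → j ≤ m → P j → j ≤ largest m
  largest-maximal zero    j≤m _ = j≤m
  largest-maximal (suc m) {j} j≤1+m p with P? (suc m)
  ... | yes _ = j≤1+m
  ... | no ¬q with m≤n⇒m<n∨m≡n j≤1+m
  ...   | inj₁ (s≤s j≤m) = largest-maximal m j≤m p
  ...   | inj₂ refl      = contradiction p ¬q

residue : ∀ {m} → 0 < m → ℕ → Fin m
residue {m} 0<m k = _mod_ k m {{>-nonZero 0<m}}

toℕ-residue : ∀ {m} (0<m : 0 < m) {k} → k < m → toℕ (residue 0<m k) ≡ k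
toℕ-residue 0<m {k} k<m =
  trans (toℕ-fromℕ< _) (m<n⇒m%n≡m {{>-nonZero 0<m}} k<m)

-- Ultrafilter calculus and unboundedness

module _ {U : Pred → Set} (isU : IsUltrafilter U) where

  open IsUltrafilter isU

  U-map : {A B : Pred} → (∀ n → A n → B n) → U A → U B
  U-map = upward _ _

  U-zip : {A B C : Pred} → (∀ n → A n → B n → C n) → U A → U B → U C
  U-zip k a b = U-map (λ n (x , y) → k n x y) (inter _ _ a b)

  U-all : {A : Pred} → (∀ n → A n) → U A
  U-all a = U-map (λ n _ → a n) full

  U-disjoint : {A B : Pred} → (∀ n → A n → ¬ B n) → U A → ¬ U B
  U-disjoint k a b = proper (U-zip k a b)

  U-complement : {A : Pred} → ¬ U A → U (λ n → ¬ A n)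
  U-complement {A} ¬a with ultra A
  ... | inj₁ a = contradiction a ¬a
  ... | inj₂ b = b

  U-stable : {A : Pred} → ¬ ¬ U A → U A
  U-stable {A} ¬¬a with ultra A
  ... | inj₁ a = a
  ... | inj₂ b = ⊥-elim (¬¬a (λ a → U-disjoint (λ _ x ¬x → ¬x x) a b))

  -- `ultra` decides whether the top value is the one taken on a large set; if not, the range
  -- shrinks by one.
  U-pigeonhole : ∀ k (u : ℕ → ℕ) → U (λ n → u n < k) → Σ (Fin k) λ i → U (λ n → u n ≡ toℕ i)
  U-pigeonhole zero    u u<k = ⊥-elim (proper (U-map (λ _ ()) u<k))
  U-pigeonhole (suc k) u u<k with ultra (λ n → u n ≡ k)
  ... | inj₁ u≡k = F.fromℕ k , U-map (λ _ eq → trans eq (sym (toℕ-fromℕ k))) u≡k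
  ... | inj₂ u≢k with U-pigeonhole k u (U-zip (λ { _ (s≤s p) q → ≤∧≢⇒< p q }) u<k u≢k)
  ...   | i , u≡i = F.inject₁ i , U-map (λ _ eq → trans eq (sym (toℕ-inject₁ i))) u≡i

  -- If f n = 0 for a single n, even outside U, then there are no representatives
  -- at all and the ultraproduct counts as finite.
  infinite⇒positive : ∀ {f} → UPInfinite U f → ∀ n → 0 < f n
  infinite⇒positive {f} inf n with f n in eq
  ... | suc _ = s≤s z≤n
  ... | zero  = contradiction (0 , (λ ()) , λ x → contradiction (subst Fin eq (x n)) λ ()) inf

  -- If `f n < k` on a large set, the `k` constant sequences, reduced modulo `f n` to be elements
  -- everywhere, represent every class by `U-pigeonhole`.
  infinite⇒unbounded : ∀ {f} → UPInfinite U f → ∀ k → U (λ n → k ≤ f n)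
  infinite⇒unbounded {f} inf k = U-stable λ ¬k≤f → inf
    (k , (λ i n → residue (pos n) (toℕ i)) , λ x →
      let i , x≡i = U-pigeonhole k (toℕ ∘ x)
            (U-map (λ n k≰f → <-trans (toℕ<n (x n)) (≰⇒> k≰f)) (U-complement ¬k≤f))
      in i , U-map (λ n eq → toℕ-injective
               (trans eq (sym (toℕ-residue (pos n) (subst (_< f n) eq (toℕ<n (x n))))))) x≡i)
    where pos = infinite⇒positive inf

-- u ≲ v says that u − v is at most infinitesimal relative to h.
module Asymptotic {U : Pred → Set} (isU : IsUltrafilter U)
                  (h : ℕ → ℕ) (h-unbounded : ∀ k → U (λ n → k ≤ h n)) where

  open IsUltrafilter isU

  -- Inequalities up to an infinitesimal

  infix 4 _≲_
  record _≲_ (u v : ℕ → ℕ) : Set where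
    field at : ∀ m → U (λ n → m * u n ≤ m * v n + h n)
  open _≲_

  ≤⇒≲ : ∀ {u v} → U (λ n → u n ≤ v n) → u ≲ v
  ≤⇒≲ u≤v .at m = U-map isU (λ n p → m≤n⇒m≤n+o (h n) (*-monoʳ-≤ m p)) u≤v

  ≤⇒≲′ : ∀ {u v} → (∀ n → u n ≤ v n) → u ≲ v
  ≤⇒≲′ u≤v = ≤⇒≲ (U-all isU u≤v)

  ≡⇒≲ : ∀ {u v} → (∀ n → u n ≡ v n) → u ≲ v
  ≡⇒≲ u≡v = ≤⇒≲′ (≤-reflexive ∘ u≡v)

  -- Both hypotheses are used at `2 * m`, so that two errors of `h / (2 * m)` add up to `h / m`.
  +-mono-≲ : ∀ {u u′ v v′ : ℕ → ℕ} → u ≲ v → u′ ≲ v′ → (λ n → u n + u′ n) ≲ (λ n → v n + v′ n)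
  +-mono-≲ {u} {u′} {v} {v′} p q .at m =
    U-zip isU (λ n → arith m (u n) (u′ n) (v n) (v′ n) (h n)) (p .at (2 * m)) (q .at (2 * m))
    where
    double : ∀ m a b → 2 * (m * (a + b)) ≡ 2 * m * a + 2 * m * b
    double = solve-∀
    regroup : ∀ m c d k → (2 * m * c + k) + (2 * m * d + k) ≡ 2 * (m * (c + d) + k)
    regroup = solve-∀
    arith : ∀ m a b c d k → 2 * m * a ≤ 2 * m * c + k → 2 * m * b ≤ 2 * m * d + k →
            m * (a + b) ≤ m * (c + d) + k
    arith m a b c d k p q = *-cancelˡ-≤ 2 (begin
      2 * (m * (a + b))                     ≡⟨ double m a b ⟩
      2 * m * a + 2 * m * b                 ≤⟨ +-mono-≤ p q ⟩
      (2 * m * c + k) + (2 * m * d + k)     ≡⟨ regroup m c d k ⟩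
      2 * (m * (c + d) + k)                 ∎)

  +-cancelʳ-≲ : ∀ {u v w : ℕ → ℕ} → (λ n → u n + w n) ≲ (λ n → v n + w n) → u ≲ v
  +-cancelʳ-≲ {u} {v} {w} p .at m =
    U-map isU (λ n → arith m (u n) (v n) (w n) (h n)) (p .at m)
    where
    regroup : ∀ m b c k → m * (b + c) + k ≡ (m * b + k) + m * c
    regroup = solve-∀
    arith : ∀ m a b c k → m * (a + c) ≤ m * (b + c) + k → m * a ≤ m * b + k
    arith m a b c k p = +-cancelʳ-≤ (m * c) _ _ (begin
      m * a + m * c      ≡⟨ *-distribˡ-+ m a c ⟨
      m * (a + c)        ≤⟨ p ⟩
      m * (b + c) + k    ≡⟨ regroup m b c k ⟩
      (m * b + k) + m * c ∎)

  ≲-refl : ∀ {u} → u ≲ u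
  ≲-refl = ≤⇒≲′ λ _ → ≤-refl

  infixr 5 _⨾_
  -- Adding the two inequalities and cancelling `v` leaves the splitting of the error to `+-mono-≲`.
  _⨾_ : ∀ {u v w} → u ≲ v → v ≲ w → u ≲ w
  _⨾_ {u} {v} {w} p q = +-cancelʳ-≲ {w = v} λ where
    .at m → U-map isU (λ n → subst (λ s → m * (u n + v n) ≤ m * s + h n) (+-comm (v n) (w n)))
                      (+-mono-≲ p q .at m)

  *-monoʳ-≲ : ∀ k {u v} → u ≲ v → (λ n → k * u n) ≲ (λ n → k * v n)
  *-monoʳ-≲ k {u} {v} p .at m =
    U-map isU (λ n r → begin
      m * (k * u n)         ≡⟨ *-assoc m k (u n) ⟨
      m * k * u n           ≤⟨ r ⟩
      m * k * v n + h n     ≡⟨ cong (_+ h n) (*-assoc m k (v n)) ⟩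
      m * (k * v n) + h n   ∎) (p .at (m * k))

  -- The error C h is absorbed by the arbitrarily large factor k.
  ≲-archimedean : ∀ C {u v : ℕ → ℕ} →
    (∀ k → (λ n → k * u n) ≲ (λ n → k * v n + C * h n)) → u ≲ v
  ≲-archimedean C {u} {v} p .at m =
    U-map isU (λ n → arith m (u n) (v n) (h n)) (p (suc C * m) .at 1)
    where
    regroup : ∀ C m b k → 1 * (suc C * m * b + C * k) + k ≡ suc C * (m * b + k)
    regroup = solve-∀
    arith : ∀ m a b k → 1 * (suc C * m * a) ≤ 1 * (suc C * m * b + C * k) + k → m * a ≤ m * b + k
    arith m a b k p = *-cancelˡ-≤ (suc C) (begin
      suc C * (m * a)                       ≡⟨ *-assoc (suc C) m a ⟨
      suc C * m * a                         ≡⟨ *-identityˡ _ ⟨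
      1 * (suc C * m * a)                   ≤⟨ p ⟩
      1 * (suc C * m * b + C * k) + k       ≡⟨ regroup C m b k ⟩
      suc C * (m * b + k)                   ∎)

  *-cancelˡ-≲ : ∀ k .{{_ : NonZero k}} {u v : ℕ → ℕ} → (λ n → k * u n) ≲ (λ n → k * v n) → u ≲ v
  *-cancelˡ-≲ k@(suc _) {u} {v} p .at m =
    U-map isU (λ n r → *-cancelˡ-≤ k (begin
      k * (m * u n)              ≡⟨ swap k m (u n) ⟩
      m * (k * u n)              ≤⟨ r ⟩
      m * (k * v n) + h n        ≤⟨ +-monoʳ-≤ _ (m≤n*m (h n) k) ⟩
      m * (k * v n) + k * h n    ≡⟨ cong (_+ k * h n) (swap k m (v n)) ⟨
      k * (m * v n) + k * h n    ≡⟨ *-distribˡ-+ k (m * v n) (h n) ⟨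
      k * (m * v n + h n)        ∎)) (p .at m)
    where
    swap : ∀ a b c → a * (b * c) ≡ b * (a * c)
    swap = solve-∀

  +-constant-≲ : ∀ c {u : ℕ → ℕ} → (λ n → u n + c) ≲ u
  +-constant-≲ c {u} .at m =
    U-map isU (λ n mc≤h → begin
      m * (u n + c)      ≡⟨ *-distribˡ-+ m (u n) c ⟩
      m * u n + m * c    ≤⟨ +-monoʳ-≤ (m * u n) mc≤h ⟩
      m * u n + h n      ∎) (h-unbounded (m * c))

  ≲-stable : ∀ {u v} → ¬ ¬ (u ≲ v) → u ≲ v
  ≲-stable ¬¬p .at m = U-stable isU λ ¬q → ¬¬p λ p → ¬q (p .at m)

  -- `ultra` is applied to a predicate constant in `n`, so a single proposition, here one about all
  -- `m`, is decided up to double negation.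
  ≲? : ∀ u v → Dec (u ≲ v)
  ≲? u v with ultra (λ _ → u ≲ v)
  ... | inj₁ p = yes (≲-stable λ ¬p → proper (U-map isU (λ _ → ¬p) p))
  ... | inj₂ q = no λ p → proper (U-map isU (λ _ ¬p → ¬p p) q)

  ≰⇒≳ : ∀ {u v} → ¬ (u ≲ v) → v ≲ u
  ≰⇒≳ ¬p = ≤⇒≲ (U-stable isU λ ¬q → ¬p (≤⇒≲ (U-map isU (λ _ → ≰⇒≥) (U-complement isU ¬q))))

  -- Standard parts as rational cuts

  record Commensurable (f : ℕ → ℕ) : Set where
    field
      positive  : ∀ n → 0 < f n
      bounded   : ∀ n → f n ≤ h n
      ratio     : ℕ
      dominates : U (λ n → h n ≤ ratio * f n)

  -- The standard part of x / f is at least a / b.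
  record AtLeast (f x : ℕ → ℕ) (a b : ℕ) : Set where
    constructor atLeast
    field multiples-≲ : (λ n → a * f n) ≲ (λ n → b * x n)
  open AtLeast

  AtLeast? : ∀ f x a b → Dec (AtLeast f x a b)
  AtLeast? f x a b = map′ atLeast multiples-≲ (≲? (λ n → a * f n) (λ n → b * x n))

  -- For `k > 0`, the standard part of `x / f` lies in the closed interval from `j / k` to
  -- `(j + 1) / k`.
  Between : (f x : ℕ → ℕ) → ℕ → ℕ → Set
  Between f x j k = AtLeast f x j k × (λ n → k * x n) ≲ (λ n → suc j * f n)

  swap : ∀ a b c → a * (b * c) ≡ b * (a * c)
  swap = solve-∀

  -- With `B < A` the hypothesis would make `f` infinitesimal; at the factor `suc ratio` it gives
  -- `suc ratio * f n ≤ h n`, against `dominates`.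
  multiples-reflect : ∀ {f} → Commensurable f → ∀ A B →
    (λ n → A * f n) ≲ (λ n → B * f n) → A ≤ B
  multiples-reflect {f} cf A B p = ≮⇒≥ λ B<A →
    U-disjoint isU (λ n → arith n B<A) (p .at (suc ratio)) dominates
    where
    open Commensurable cf
    expand : ∀ c b y → suc c * (y + b * y) ≡ suc c * (b * y) + suc c * y
    expand = solve-∀
    arith : ∀ n → B < A → suc ratio * (A * f n) ≤ suc ratio * (B * f n) + h n → ¬ h n ≤ ratio * f n
    arith n B<A p q = <⇒≱ (m<n+m (ratio * f n) (positive n)) (≤-trans
      (+-cancelˡ-≤ (suc ratio * (B * f n)) _ _ (begin
        suc ratio * (B * f n) + suc ratio * f n   ≡⟨ expand ratio B (f n) ⟨
        suc ratio * (suc B * f n)                 ≤⟨ *-monoʳ-≤ (suc ratio) (*-monoˡ-≤ (f n) B<A) ⟩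
        suc ratio * (A * f n)                     ≤⟨ p ⟩
        suc ratio * (B * f n) + h n               ∎)) q)

  -- The common `j` links the two sides: `a / b ≤ (j + 1) / k` is an inequality of integers, so it
  -- can be read over `g`, where `j / k` bounds `v / g` from below. The gap `1 / k` vanishes as `k`
  -- grows.
  AtLeast-transfer : ∀ {f g u v} → Commensurable f → Commensurable g →
    (∀ k → ∃ λ j → Between f u j k × Between g v j k) →
    ∀ {a b} → AtLeast f u a b → AtLeast g v a b
  AtLeast-transfer {f} {g} {u} {v} cf cg same {a} {b} (atLeast p) = atLeast (≲-archimedean b step)
    where
    open Commensurable cg
    step : ∀ k → (λ n → k * (a * g n)) ≲ (λ n → k * (b * v n) + b * h n)
    step k with same k
    ... | j , (_ , u≲) , (atLeast ≲v , _) =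
        ≤⇒≲′ (λ n → begin
          k * (a * g n)            ≡⟨ *-assoc k a (g n) ⟨
          k * a * g n              ≤⟨ *-monoˡ-≤ (g n) ka≤ ⟩
          b * suc j * g n          ≡⟨ expand b j (g n) ⟩
          b * (j * g n) + b * g n  ∎)
      ⨾ +-mono-≲ (*-monoʳ-≲ b ≲v ⨾ ≡⇒≲ (λ n → swap b k (v n)))
                 (≤⇒≲′ (λ n → *-monoʳ-≤ b (bounded n)))
      where
      expand : ∀ b j y → b * suc j * y ≡ b * (j * y) + b * y
      expand = solve-∀
      ka≤ : k * a ≤ b * suc j
      ka≤ = multiples-reflect cf (k * a) (b * suc j)
        ( ≡⇒≲ (λ n → *-assoc k a (f n))
        ⨾ *-monoʳ-≲ k p
        ⨾ ≡⇒≲ (λ n → swap k b (u n))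
        ⨾ *-monoʳ-≲ b u≲
        ⨾ ≡⇒≲ (λ n → sym (*-assoc b (suc j) (f n))))

  -- Within one interval of length `1 / k`, `u` exceeds `v` by at most about `f / k`, and `f ≤ h`.
  Between⇒≲ : ∀ {f u v} → Commensurable f →
    (∀ k → ∃ λ j → Between f u j k × Between f v j k) → u ≲ v
  Between⇒≲ {f} {u} {v} cf same = ≲-archimedean 1 λ k →
    let j , (_ , u≲) , (atLeast ≲v , _) = same k in
      u≲
    ⨾ ≡⇒≲ (λ n → +-comm (f n) (j * f n))
    ⨾ +-mono-≲ ≲v (≤⇒≲′ (λ n → ≤-trans (bounded n) (≤-reflexive (sym (*-identityˡ (h n))))))
    where open Commensurable cf

  AtLeast-weaken : ∀ {f x a b c d} .{{_ : NonZero b}} → c * b ≤ a * d →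
    AtLeast f x a b → AtLeast f x c d
  AtLeast-weaken {f} {x} {a} {b} {c} {d} cb≤ad (atLeast p) = atLeast (*-cancelˡ-≲ b
    ( ≤⇒≲′ (λ n → begin
        b * (c * f n)   ≡⟨ left b c (f n) ⟩
        c * b * f n     ≤⟨ *-monoˡ-≤ (f n) cb≤ad ⟩
        a * d * f n     ≡⟨ left d a (f n) ⟨
        d * (a * f n)   ∎)
    ⨾ *-monoʳ-≲ d p
    ⨾ ≡⇒≲ (λ n → swap d b (x n))))
    where
    left : ∀ b c y → b * (c * y) ≡ c * b * y
    left = solve-∀

  AtLeast-mono : ∀ {f x y} → x ≲ y → ∀ {a b} → AtLeast f x a b → AtLeast f y a b
  AtLeast-mono x≲y {b = b} (atLeast p) = atLeast (p ⨾ *-monoʳ-≲ b x≲y)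

  -- ⌊ t m ⌋, where t ≤ 1 is the standard part of x / f.
  part : (f x : ℕ → ℕ) → ℕ → ℕ
  part f x m = largest (λ j → AtLeast? f x j m) m

  module _ (f x : ℕ → ℕ) where

    part-≤ : ∀ m → part f x m ≤ m
    part-≤ m = largest-≤ _ m

    part-AtLeast : ∀ m → AtLeast f x (part f x m) m
    part-AtLeast m = largest-satisfies (λ j → AtLeast? f x j m) (atLeast (≤⇒≲′ λ _ → z≤n)) m

    part-maximal : ∀ m {j} → j ≤ m → AtLeast f x j m → j ≤ part f x m
    part-maximal m = largest-maximal _ m

  part-mono : ∀ {f x g y} → (∀ {a b} → AtLeast f x a b → AtLeast g y a b) →
    ∀ m → part f x m ≤ part g y m
  part-mono {f} {x} {g} {y} k m = part-maximal g y m (part-≤ f x m) (k (part-AtLeast f x m))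

  Between-part : ∀ f x → (∀ n → x n ≤ f n) → ∀ k → Between f x (part f x k) k
  Between-part f x x≤f k = part-AtLeast f x k , upper
    where
    j = part f x k
    upper : (λ n → k * x n) ≲ (λ n → suc j * f n)
    upper with m≤n⇒m<n∨m≡n (part-≤ f x k)
    ... | inj₁ j<k = ≰⇒≳ λ p → <⇒≱ ≤-refl (part-maximal f x k j<k (atLeast p))
    -- The search stops at `k`, so maximality says nothing here; the bound comes from `x ≤ f`.
    ... | inj₂ j≡k = ≤⇒≲′ λ n →
      *-mono-≤ (≤-trans (≤-reflexive (sym j≡k)) (n≤1+n j)) (x≤f n)

  -- The floor of `j * g n / k` is a candidate in the search for `part f x (g n)`, whence the lower
  -- bound; a value beyond the upper bound would contradict the maximality of `part f x k`.
  part-Between : ∀ f x g → (∀ n → 0 < g n) →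
    ∀ k → Between g (λ n → part f x (g n)) (part f x k) k
  part-Between f x g 0<g k = lower k , ≤⇒≲′ upper
    where
    lower : ∀ k → AtLeast g (λ n → part f x (g n)) (part f x k) k
    lower zero      = atLeast (≤⇒≲′ λ _ → z≤n)
    -- Rounding costs at most the constant `k`, which is infinitesimal.
    lower k@(suc _) = atLeast (≤⇒≲′ (arith ∘ g) ⨾ +-constant-≲ k)
      where
      j = part f x k
      arith : ∀ m → j * m ≤ k * part f x m + k
      arith m = begin
        j * m                              ≡⟨ m≡m%n+[m/n]*n (j * m) k ⟩
        (j * m) % k + (j * m) / k * k      ≤⟨ +-mono-≤ (m%n≤n (j * m) k) (*-monoˡ-≤ k q≤) ⟩
        k + part f x m * k                 ≡⟨ +-comm k _ ⟩
        part f x m * k + k                 ≡⟨ cong (_+ k) (*-comm (part f x m) k) ⟩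
        k * part f x m + k                 ∎
        where
        q≤ : (j * m) / k ≤ part f x m
        q≤ = part-maximal f x m
          (*-cancelʳ-≤ _ _ k (begin
            (j * m) / k * k  ≤⟨ m/n*n≤m (j * m) k ⟩
            j * m            ≤⟨ *-monoˡ-≤ m (part-≤ f x k) ⟩
            k * m            ≡⟨ *-comm k m ⟩
            m * k            ∎))
          (AtLeast-weaken (m/n*n≤m (j * m) k) (part-AtLeast f x k))
    upper : ∀ n → k * part f x (g n) ≤ suc (part f x k) * g n
    upper n with m≤n⇒m<n∨m≡n (part-≤ f x k)
    ... | inj₂ j≡k = *-mono-≤ (≤-trans (≤-reflexive (sym j≡k)) (n≤1+n _)) (part-≤ f x (g n))
    ... | inj₁ j<k = ≮⇒≥ λ lt → <⇒≱ ≤-refl (part-maximal f x k j<k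
      (AtLeast-weaken {{>-nonZero (0<g n)}}
        (≤-trans (<⇒≤ lt) (≤-reflexive (*-comm k (part f x (g n)))))
        (part-AtLeast f x (g n))))

  -- The translation from `f` to `g`

  module Shift {f g : ℕ → ℕ} (cf : Commensurable f) (cg : Commensurable g) where

    open Commensurable

    module Balance (x : ℕ → ℕ) (x<f : ∀ n → x n < f n) where

      private
        r = part f x
        x-Between = Between-part f x (<⇒≤ ∘ x<f)

      x≲part : x ≲ (λ n → r (f n))
      x≲part = Between⇒≲ cf λ k → r k , x-Between k , part-Between f x f (positive cf) k

      part≲x : (λ n → r (f n)) ≲ x
      part≲x = Between⇒≲ cf λ k → r k , part-Between f x f (positive cf) k , x-Between k

      AtLeast⇒part : ∀ {a b} → AtLeast f x a b → AtLeast g (λ n → r (g n)) a b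
      AtLeast⇒part = AtLeast-transfer cf cg λ k →
        r k , x-Between k , part-Between f x g (positive cg) k

      part⇒AtLeast : ∀ {a b} → AtLeast g (λ n → r (g n)) a b → AtLeast f x a b
      part⇒AtLeast = AtLeast-transfer cg cf λ k →
        r k , part-Between f x g (positive cg) k , x-Between k

      part-zero : (∀ p → ¬ AtLeast f x 1 p) → ∀ m → r m ≡ 0
      part-zero ¬p zero = refl
      part-zero ¬p m@(suc _) with r m | part-AtLeast f x m
      ... | zero  | _ = refl
      ... | suc j | q = contradiction (AtLeast-weaken (*-monoˡ-≤ m {1} {suc j} (s≤s z≤n)) q) (¬p m)

      part-full : AtLeast f x 1 1 → ∀ m → r m ≡ m
      part-full p m = ≤-antisym (part-≤ f x m) (part-maximal f x m ≤-refl
        (AtLeast-weaken (≤-reflexive (*-comm m 1)) p))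

      -- If the standard part is 0, both floors vanish. If it is at least `1 / p`, then `r (g n)` is
      -- of the order of `g n` and outweighs the infinitesimal `r (f n) - x n`. Assuming `¬ok`
      -- excludes the second case.
      no-underflow : U (λ n → r (f n) ≤ x n + r (g n))
      no-underflow = U-stable isU λ ¬ok → ¬ok (U-all isU λ n →
        ≤-trans (≤-reflexive (part-zero (λ p q → ¬ok (positive-case p q)) (f n))) z≤n)
        where
        c = ratio cg
        arith : ∀ p a b x y k → k ≤ c * y → 2 * c * (1 * y) ≤ 2 * c * (p * b) + k →
                suc (2 * c * p) * a ≤ suc (2 * c * p) * x + k → a ≤ x + b
        arith p a b x y k k≤ y≤ a≤ = *-cancelˡ-≤ M (begin
          M * a          ≤⟨ a≤ ⟩
          M * x + k      ≤⟨ +-monoʳ-≤ (M * x) k≤Mb ⟩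
          M * x + M * b  ≡⟨ *-distribˡ-+ M x b ⟨
          M * (x + b)    ∎)
          where
          -- As `k ≤ c * y`, the factor 2 leaves one `k` over after absorbing the error:
          -- `k ≤ 2 * c * p * b`. So `k / M ≤ b`, and `suc` keeps `M` nonzero.
          M = suc (2 * c * p)
          double : ∀ c y → c * y + c * y ≡ 2 * c * (1 * y)
          double = solve-∀
          k≤Mb : k ≤ M * b
          k≤Mb = +-cancelʳ-≤ k k (M * b) (begin
            k + k                  ≤⟨ +-mono-≤ k≤ k≤ ⟩
            c * y + c * y          ≡⟨ double c y ⟩
            2 * c * (1 * y)        ≤⟨ y≤ ⟩
            2 * c * (p * b) + k    ≡⟨ cong (_+ k) (*-assoc (2 * c) p b) ⟨
            2 * c * p * b + k      ≤⟨ +-monoˡ-≤ k (m≤n+m (2 * c * p * b) b) ⟩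
            M * b + k              ∎)
        positive-case : ∀ p → AtLeast f x 1 p → U (λ n → r (f n) ≤ x n + r (g n))
        positive-case p q =
          U-zip isU (λ n (k≤ , y≤) a≤ → arith p (r (f n)) (r (g n)) (x n) (g n) (h n) k≤ y≤ a≤)
            (inter _ _ (dominates cg) (multiples-≲ (AtLeast⇒part q) .at (2 * c)))
            (part≲x .at (suc (2 * c * p)))

      -- If the standard part is 1, the floors are exact and the claim reduces to `x n < f n`.
      -- Otherwise a failure would make `g n - r (g n)` at most the infinitesimal `x n - r (f n)`,
      -- forcing standard part 1.
      no-overflow : U (λ n → x n + r (g n) < g n + r (f n))
      no-overflow with AtLeast? f x 1 1
      ... | yes p = U-all isU λ n → begin-strict
        x n + r (g n)  ≡⟨ cong (x n +_) (part-full p (g n)) ⟩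
        x n + g n      <⟨ +-monoˡ-< (g n) (x<f n) ⟩
        f n + g n      ≡⟨ +-comm (f n) (g n) ⟩
        g n + f n      ≡⟨ cong (g n +_) (part-full p (f n)) ⟨
        g n + r (f n)  ∎
      ... | no ¬p = U-stable isU λ ¬ok → ¬p (part⇒AtLeast λ where
        .multiples-≲ .at m → U-stable isU λ ¬le → ¬ok
          (U-zip isU (λ n lt → arith m (r (f n)) (r (g n)) (x n) (g n) (h n) (≰⇒> lt))
            (U-complement isU ¬le) (x≲part .at m)))
        where
        regroup : ∀ m a b k → (m * a + k) + m * b ≡ (m * (1 * b) + k) + m * a
        regroup = solve-∀
        collect : ∀ m a y → m * (1 * y) + m * a ≡ m * (y + a)
        collect = solve-∀
        arith : ∀ m a b x y k → m * (1 * b) + k < m * (1 * y) → m * x ≤ m * a + k → x + b < y + a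
        arith m a b x y k lt x≤ = *-cancelˡ-< m _ _ (begin-strict
          m * (x + b)                  ≡⟨ *-distribˡ-+ m x b ⟩
          m * x + m * b                ≤⟨ +-monoˡ-≤ (m * b) x≤ ⟩
          (m * a + k) + m * b          ≡⟨ regroup m a b k ⟩
          (m * (1 * b) + k) + m * a    <⟨ +-monoˡ-< (m * a) lt ⟩
          m * (1 * y) + m * a          ≡⟨ collect m a y ⟩
          m * (y + a)                  ∎)

    -- Truncated subtraction and `residue` only make the map total; on a large set neither alters
    -- the value.
    shift : Elt f → Elt g
    shift x n = residue (positive cg n)
      ((toℕ (x n) + part f (toℕ ∘ x) (g n)) ∸ part f (toℕ ∘ x) (f n))

    module _ (x : Elt f) where

      open Balance (toℕ ∘ x) (λ n → toℕ<n (x n))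

      private
        r = part f (toℕ ∘ x)
        y = toℕ ∘ shift x

      shift-balance : U (λ n → y n + r (f n) ≡ toℕ (x n) + r (g n))
      shift-balance = U-zip isU (λ n lo hi →
        trans (cong (_+ r (f n)) (toℕ-residue (positive cg n)
                (+-cancelʳ-< (r (f n)) _ _
                  (subst (_< g n + r (f n)) (sym (m∸n+n≡m lo)) hi))))
              (m∸n+n≡m lo)) no-underflow no-overflow

      shift≲part : y ≲ (λ n → r (g n))
      shift≲part = +-cancelʳ-≲ {w = λ n → r (f n)}
        ( ≤⇒≲ (U-map isU (λ _ → ≤-reflexive) shift-balance)
        ⨾ +-mono-≲ x≲part ≲-refl
        ⨾ ≡⇒≲ (λ n → +-comm (r (f n)) (r (g n))))

      part≲shift : (λ n → r (g n)) ≲ y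
      part≲shift = +-cancelʳ-≲ {w = λ n → r (f n)}
        ( ≡⇒≲ (λ n → +-comm (r (g n)) (r (f n)))
        ⨾ +-mono-≲ part≲x ≲-refl
        ⨾ ≤⇒≲ (U-map isU (λ _ → ≤-reflexive ∘ sym) shift-balance))

      AtLeast⇒shift : ∀ {a b} → AtLeast f (toℕ ∘ x) a b → AtLeast g y a b
      AtLeast⇒shift p = AtLeast-mono part≲shift (AtLeast⇒part p)

      shift⇒AtLeast : ∀ {a b} → AtLeast g y a b → AtLeast f (toℕ ∘ x) a b
      shift⇒AtLeast p = part⇒AtLeast (AtLeast-mono shift≲part p)

      -- Infinitesimally close to its base point, the image has the same rational lower bounds as
      -- `x`; the floors then agree at every `m`, not only on a large set.
      part-shift : ∀ m → part g y m ≡ r m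
      part-shift m = ≤-antisym (part-mono shift⇒AtLeast m) (part-mono AtLeast⇒shift m)

    shift-<-same-part : ∀ x y → (∀ m → part f (toℕ ∘ x) m ≡ part f (toℕ ∘ y) m) →
      x <[ U ] y → shift x <[ U ] shift y
    shift-<-same-part x y same x<y = U-zip isU (λ n lt (p , q) →
      +-cancelʳ-< (part f (toℕ ∘ x) (f n)) _ _ (begin-strict
        toℕ (shift x n) + part f (toℕ ∘ x) (f n)  ≡⟨ p ⟩
        toℕ (x n) + part f (toℕ ∘ x) (g n)        <⟨ +-monoˡ-< _ lt ⟩
        toℕ (y n) + part f (toℕ ∘ x) (g n)        ≡⟨ cong (toℕ (y n) +_) (same (g n)) ⟩
        toℕ (y n) + part f (toℕ ∘ y) (g n)        ≡⟨ q ⟨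
        toℕ (shift y n) + part f (toℕ ∘ y) (f n)  ≡⟨ cong (toℕ (shift y n) +_) (same (f n)) ⟨
        toℕ (shift y n) + part f (toℕ ∘ x) (f n)  ∎))
      x<y (inter _ _ (shift-balance x) (shift-balance y))

    -- A failure would give `shift y ≤ shift x` on a large set, so the standard part of `y` would
    -- not exceed that of `x`. With `x < y` they coincide, and both elements are translated by the
    -- same amount.
    shift-< : ∀ x y → x <[ U ] y → shift x <[ U ] shift y
    shift-< x y x<y = U-stable isU λ ¬lt → ¬lt (shift-<-same-part x y (λ m → ≤-antisym
      (part-mono (AtLeast-mono (≤⇒≲ (U-map isU (λ _ → <⇒≤) x<y))) m)
      (part-mono (λ p → shift⇒AtLeast x (AtLeast-mono
        (≤⇒≲ (U-map isU (λ _ → ≮⇒≥) (U-complement isU ¬lt))) (AtLeast⇒shift y p))) m)) x<y)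

    shift-cong : ∀ x y → x ≈[ U ] y → shift x ≈[ U ] shift y
    shift-cong x y x≈y = U-map isU (λ n eq → shift-≡ n (cong toℕ eq)) x≈y
      where
      same : ∀ m → part f (toℕ ∘ x) m ≡ part f (toℕ ∘ y) m
      same m = ≤-antisym
        (part-mono (AtLeast-mono (≤⇒≲ (U-map isU (λ _ → ≤-reflexive ∘ cong toℕ) x≈y))) m)
        (part-mono (AtLeast-mono (≤⇒≲ (U-map isU (λ _ → ≤-reflexive ∘ sym ∘ cong toℕ) x≈y))) m)
      shift-≡ : ∀ n → toℕ (x n) ≡ toℕ (y n) → shift x n ≡ shift y n
      shift-≡ n eq rewrite eq | same (g n) | same (f n) = refl

  -- The inverse and the isomorphism

  module _ {f g : ℕ → ℕ} (cf : Commensurable f) (cg : Commensurable g) where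

    private
      module S = Shift cf cg
      module T = Shift cg cf

    -- The floors for `S.shift x` are those for `x`, so the second balance equation undoes the
    -- first.
    shift-inverse : ∀ x → T.shift (S.shift x) ≈[ U ] x
    shift-inverse x = U-zip isU (λ n p q → toℕ-injective
      (+-cancelʳ-≡ (r (g n)) _ _ (begin-equality
        toℕ (T.shift y n) + r (g n)                ≡⟨ cong (toℕ (T.shift y n) +_) (S.part-shift x (g n)) ⟨
        toℕ (T.shift y n) + part g (toℕ ∘ y) (g n) ≡⟨ q ⟩
        toℕ (y n) + part g (toℕ ∘ y) (f n)         ≡⟨ cong (toℕ (y n) +_) (S.part-shift x (f n)) ⟩
        toℕ (y n) + r (f n)                        ≡⟨ p ⟩
        toℕ (x n) + r (g n)                        ∎)))
      (S.shift-balance x) (T.shift-balance y)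
      where
      y = S.shift x
      r = part f (toℕ ∘ x)

  -- `T.shift` also respects equality and order, so applying it yields injectivity and reflection of
  -- the order.
  shift-iso : ∀ {f g} → Commensurable f → Commensurable g → UPIso U f g
  shift-iso cf cg =
    S.shift , S.shift-cong
    , (λ x y p → U-zip isU (λ { n eq (eq₁ , eq₂) → trans (sym eq₁) (trans eq eq₂) })
        (T.shift-cong _ _ p) (inter _ _ (shift-inverse cf cg x) (shift-inverse cf cg y)))
    , (λ z → T.shift z , shift-inverse cg cf z)
    , λ x y → S.shift-< x y , λ p →
        U-zip isU (λ { n lt (eq₁ , eq₂) → subst₂ F._<_ eq₁ eq₂ lt }) (T.shift-< _ _ p)
          (inter _ _ (shift-inverse cf cg x) (shift-inverse cf cg y))
    where
    module S = Shift cf cg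
    module T = Shift cg cf

theorem3p1 : (U : Pred → Set) → IsUltrafilter U → (f g : ℕ → ℕ) → LimRatioPos U f g → LimRatioFinite U f g → UPInfinite U f → UPInfinite U g → UPIso U f g
theorem3p1 U isU f g (a , b , g≲f) (c , d , f≲g) f-inf g-inf =
  shift-iso
    (record
      { positive  = infinite⇒positive isU f-inf
      ; bounded   = λ n → m≤m+n (f n) (g n)
      -- On a large set `g ≤ suc a * g < suc b * f`, so `f + g ≤ (b + 2) * f`.
      ; ratio     = suc (suc b)
      ; dominates = U-map isU (λ n (_ , lt) → +-monoʳ-≤ (f n)
          (≤-trans (m≤n*m (g n) (suc a)) (<⇒≤ lt))) g≲f })
    (record
      { positive  = infinite⇒positive isU g-inf
      ; bounded   = λ n → m≤n+m (g n) (f n)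
      ; ratio     = suc c
      ; dominates = U-map isU (λ n (_ , lt) → ≤-trans
          (+-monoˡ-≤ (g n) (≤-trans (m≤n*m (f n) (suc d)) (<⇒≤ lt)))
          (≤-reflexive (+-comm (c * g n) (g n)))) f≲g })
  where
  -- The scale `f + g` bounds both functions everywhere and is comparable to each on a large set; it
  -- is unbounded because `f` is.
  open Asymptotic isU (λ n → f n + g n)
    (λ k → U-map isU (λ n k≤f → m≤n⇒m≤n+o (g n) k≤f) (infinite⇒unbounded isU f-inf k))
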